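{- Let $\mathrm{Var}=\{x,y,r_0,r_1\}$ (four distinct variables) and $\mathrm{Val}=\{0,1\}$, and let $t$ be the POCKA-term $$t=\big((r_0=0)\wedge(r_1=0)\big)\cdot\Big(\big((x\leftarrow1)\cdot(r_0\leftarrow y)\big)\parallel\big((y\leftarrow1)\cdot(r_1\leftarrow x)\big)\Big)\cdot\overline{(r_0=1)\vee(r_1=1)}.$$ Then the semantics of $t$ contains no guarded pomsets: $(\!|t|\!){\downarrow}\cap\mathcal G=\emptyset$.
   Context: **States and observations.** $\mathsf{State}$ is the set of partial functions $\alpha:\mathrm{Var}\rightharpoonup\mathrm{Val}$, ordered by $\alpha\le\beta$ iff $\mathrm{dom}(\beta)\subseteq\mathrm{dom}(\alpha)$ and $\alpha(x)=\beta(x)$ for all $x\in\mathrm{dom}(\beta)$. $\mathsf{Act}$ is the set of formal symbols $(v\leftarrow n)$ and $(v\leftarrow v')$, and $\mathsf{Obs}$ the set of formal symbols $(v=n)$, for $v,v'\in\mathrm{Var}$, $n\in\mathrm{Val}$. Observation terms $\mathcal O$: $p,q::=\bot\mid\top\mid o\in\mathsf{Obs}\mid p\vee q\mid p\wedge q\mid\overline p$. With $P_\le(\mathsf{State})$ the set of downwards-closed subsets of $\mathsf{State}$, $[\![-]\!]_{\mathrm{OA}}:\mathcal O\to P_\le(\mathsf{State})$ is the homomorphism with $[\![\bot]\!]=\emptyset$, $[\![\top]\!]=\mathsf{State}$, $[\![v=n]\!]=\{\alpha:\alpha(v)=n\}$, $\vee\mapsto\cup$, $\wedge\mapsto\cap$,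 $[\![\overline p]\!]=\bigcup\{Z\in P_\le(\mathsf{State}): [\![p]\!]\cap Z=\emptyset\}$. **Terms.** For an alphabet $\Sigma$, $\mathcal E_\Sigma$ is generated by $e,f::=0\mid1\mid a\in\Sigma\mid e+f\mid e\cdot f\mid e\parallel f\mid e^*$. POCKA-terms are $\mathcal T=\mathcal E_{\mathsf{Act}\cup\mathcal O}$. **Pomsets.** A pomset over $\Sigma$ is an isomorphism class of finite $\Sigma$-labelled posets; $1$ is the empty pomset, and a letter denotes the corresponding one-node pomset. $U\parallel V$ is the disjoint union; $U\cdot V$ is the disjoint union with additionally every node of $U$ below every node of $V$. $\mathsf{SP}(\Sigma)$ is the smallest set of pomsets containing $1$ and all letters and closed under $\cdot$ and $\parallel$. Operations lift pointwise to languages; $L^*=\bigcup_n L^n$. BKA-semantics $[\![-]\!]_{\mathrm{BKA}}:\mathcal E_\Sigma\to2^{\mathsf{SP}(\Sigma)}$: $0\mapsto\emptyset$, $1\mapsto\{1\}$, $a\mapsto\{a\}$, $+\mapsto\cup$, and $\cdot,\parallel,{}^*$ to the language operations. **Closure.** A pomset context $C\in\mathsf{PC}(\Sigma)$ is a series-parallel pomset over $\Sigma\cup\{*\}$ with exactly one node labelled $*$; $C[U]$ is obtained by substituting $U$ for that node, and $C[L]=\{C[U]:U\in L\}$. For a set $H$ of hypotheses (formal inequations $e\le f$ with $e,f\in\mathcal E_\Sigma$), $L{\downarrow^H}$ is the smallest language containing $L$ such that whenever $e\le f\in H$, $C\in\mathsf{PC}(\Sigma)$ and $C[[\![f]\!]_{\mathrm{BKA}}]\subseteq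 L{\downarrow^H}$, also $C[[\![e]\!]_{\mathrm{BKA}}]\subseteq L{\downarrow^H}$. **POCKA-semantics.** Take $\Sigma=\mathsf{Act}\cup\mathsf{State}$. Define $(\!|-|\!):\mathcal T\to2^{\mathsf{SP}(\Sigma)}$ by $(\!|a|\!)=\mathsf{State}^*\cdot\{a\}\cdot\mathsf{State}^*$ for $a\in\mathsf{Act}$, $(\!|p|\!)=\mathsf{State}^*\cdot[\![p]\!]_{\mathrm{OA}}\cdot\mathsf{State}^*$ for $p\in\mathcal O$, $(\!|0|\!)=\emptyset$, $(\!|1|\!)=\{1\}$, $(\!|e+f|\!)=(\!|e|\!)\cup(\!|f|\!)$, $(\!|e\cdot f|\!)=(\!|e|\!)\cdot(\!|f|\!)$, $(\!|e\parallel f|\!)=(\!|e|\!)\parallel(\!|f|\!)$, $(\!|e^*|\!)=(\!|e|\!)^*$. Let $\mathsf{exch}=\{(e\parallel f)\cdot(g\parallel h)\le(e\cdot g)\parallel(f\cdot h): e,f,g,h\in\mathcal E_\Sigma\}$, $\mathsf{contr}=\{\alpha\le\alpha\cdot\alpha:\alpha\in\mathsf{State}\}$, and $(\!|e|\!){\downarrow}=(\!|e|\!){\downarrow^{\mathsf{exch}\cup\mathsf{contr}}}$. **Guarded pomsets.** For $\alpha\in\mathsf{State}$, $a\in\mathsf{Act}$: $\alpha[a]$ exists if $a=(v\leftarrow n)$ with $n\in\mathrm{Val}$, or $a=(v\leftarrow v')$ with $v'\in\mathrm{dom}(\alpha)$; then $\alpha[v\leftarrow n]$ maps $v$ to $n$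 and agrees with $\alpha$ (including undefinedness) elsewhere, and $\alpha[v\leftarrow v']$ maps $v$ to $\alpha(v')$ and agrees with $\alpha$ elsewhere. $\alpha\oplus\beta$ is defined iff $\alpha(v)=\beta(v)$ for all $v\in\mathrm{dom}(\alpha)\cap\mathrm{dom}(\beta)$, and then equals $\alpha\cup\beta$. $\mathcal G$ is the smallest set of pomsets over $\mathsf{Act}\cup\mathsf{State}$ such that (for $\alpha,\beta,\gamma,\delta\in\mathsf{State}$, $a\in\mathsf{Act}$): $\alpha\in\mathcal G$; $\alpha\cdot a\cdot\alpha[a]\in\mathcal G$ if $\alpha[a]$ exists; if $U\cdot\alpha\in\mathcal G$ and $\alpha\cdot V\in\mathcal G$ then $U\cdot\alpha\cdot V\in\mathcal G$; if $\alpha\cdot U\cdot\beta\in\mathcal G$, $\gamma\cdot V\cdot\delta\in\mathcal G$ and $\alpha\oplus\gamma$, $\beta\oplus\delta$ are defined, then $(\alpha\oplus\gamma)\cdot(U\parallel V)\cdot(\beta\oplus\delta)\in\mathcal G$. -}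

module Defs where

open import Data.Empty using (⊥; ⊥-elim)
open import Data.Fin using (Fin; zero; suc)
open import Data.Fin.Patterns using (0F; 1F; 2F; 3F)
open import Data.Fin.Properties using (+↔⊎)
open import Data.Maybe using (Maybe; just; nothing; _<∣>_; maybe′)
import Data.Maybe as Maybe
open import Data.Nat using (ℕ; zero; suc)
import Data.Nat as ℕ
open import Data.Product using (Σ; ∃; ∃-syntax; ∃!; _×_; _,_)
open import Data.Product.Function.Dependent.Propositional using (Σ-↔)
open import Data.Sum using (_⊎_; inj₁; inj₂; [_,_]′)
open import Data.Sum.Function.Propositional using (_⊎-↔_)
open import Data.Sum.Relation.Binary.LeftOrder using (_⊎-<_; ⊎-<-isPartialOrder)
open import Data.Sum.Relation.Binary.Pointwise
  using (Pointwise; ⊎-isPartialOrder; Pointwise-≡⇒≡; ≡⇒Pointwise-≡)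
open import Data.Unit using (⊤; tt)
open import Data.Vec using (Vec; lookup; zipWith; _[_]≔_)
open import Function using (_∘_; _⇔_; _↔_; Inverse; mk↔ₛ′)
open import Function.Properties.Inverse using (↔-refl; ↔-sym; ↔-trans)
import Level
open import Level using (0ℓ) renaming (suc to lsuc)
open import Relation.Binary.Core using (Rel)
open import Relation.Binary.Construct.Union using () renaming (_∪_ to _∪ᴿ_)
open import Relation.Binary.PropositionalEquality
  using (_≡_; _≢_; refl; trans; cong; isEquivalence)
open import Relation.Binary.Structures using (IsPartialOrder)
open import Relation.Unary using (Pred; _∈_; _⊆_; _∩_; _∪_; Empty)

private
  variable
    A B : Set

Finite : Set → Set
Finite X = ∃[ n ] (X ↔ Fin n)

⊎-finite : Finite A → Finite B → Finite (A ⊎ B)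
⊎-finite (m , f) (n , g) = m ℕ.+ n , ↔-trans (f ⊎-↔ g) (↔-sym +↔⊎)

Σ-Fin-finite : ∀ n {F : Fin n → Set} → (∀ i → Finite (F i)) → Finite (Σ (Fin n) F)
Σ-Fin-finite zero    fin = 0 , mk↔ₛ′ (λ ()) (λ ()) (λ ()) (λ ())
Σ-Fin-finite (suc n) {F} fin =
  let k , f = ⊎-finite (fin zero) (Σ-Fin-finite n (fin ∘ suc)) in k , ↔-trans split f
  where
  split : Σ (Fin (suc n)) F ↔ (F zero ⊎ Σ (Fin n) (F ∘ suc))
  split = mk↔ₛ′
    (λ { (zero , z) → inj₁ z ; (suc i , z) → inj₂ (i , z) })
    [ (λ z → zero , z) , (λ (i , z) → suc i , z) ]′
    (λ { (inj₁ _) → refl ; (inj₂ _) → refl })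
    (λ { (zero , _) → refl ; (suc _ , _) → refl })

Σ-finite : {F : A → Set} → Finite A → (∀ a → Finite (F a)) → Finite (Σ A F)
Σ-finite (n , f) fin =
  let k , g = Σ-Fin-finite n (fin ∘ Inverse.from f)
  in  k , ↔-trans (↔-sym (Σ-↔ (↔-sym f) ↔-refl)) g

-- A pomset is represented by any labelled poset in its isomorphism class;
-- equality of pomsets is the isomorphism _≅_, and all sets of pomsets below
-- are closed under it.

record Pomset (A : Set) : Set₁ where
  field
    Node           : Set
    finite         : Finite Node
    _≤_            : Rel Node 0ℓ
    isPartialOrder : IsPartialOrder _≡_ _≤_
    label          : Node → A

infix 4 _≅_

record _≅_ (V W : Pomset A) : Set where
  private
    module V = Pomset V
    module W = Pomset W
  field
    bijection : V.Node ↔ W.Node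
  open Inverse bijection public using (to; from)
  field
    label-≡ : ∀ v → W.label (to v) ≡ V.label v
    order   : ∀ v v′ → (v V.≤ v′) ⇔ (to v W.≤ to v′)

private
  ≡-isPartialOrder : IsPartialOrder {A = A} _≡_ _≡_
  ≡-isPartialOrder = record
    { isPreorder = record
      { isEquivalence = isEquivalence ; reflexive = λ e → e ; trans = trans }
    ; antisym = λ e _ → e
    }

  fromPointwise : {R : Rel (A ⊎ B) 0ℓ} →
    IsPartialOrder (Pointwise _≡_ _≡_) R → IsPartialOrder _≡_ R
  fromPointwise po = record
    { isPreorder = record
      { isEquivalence = isEquivalence
      ; reflexive     = P.reflexive ∘ ≡⇒Pointwise-≡
      ; trans         = P.trans
      }
    ; antisym = λ p q → Pointwise-≡⇒≡ (P.antisym p q)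
    }
    where module P = IsPartialOrder po

empty : Pomset A
empty = record
  { Node = ⊥ ; finite = 0 , mk↔ₛ′ (λ ()) (λ ()) (λ ()) (λ ())
  ; _≤_ = _≡_ ; isPartialOrder = ≡-isPartialOrder ; label = λ () }

letter : A → Pomset A
letter a = record
  { Node = ⊤
  ; finite = 1 , mk↔ₛ′ (λ _ → zero) (λ _ → tt) (λ { zero → refl }) (λ _ → refl)
  ; _≤_ = _≡_ ; isPartialOrder = ≡-isPartialOrder ; label = λ _ → a }

infixr 7 _·ₚ_
infixr 6 _∥ₚ_

_·ₚ_ _∥ₚ_ : Pomset A → Pomset A → Pomset A

V ·ₚ W = record
  { Node           = V.Node ⊎ W.Node
  ; finite         = ⊎-finite V.finite W.finite
  ; _≤_            = V._≤_ ⊎-< W._≤_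
  ; isPartialOrder = fromPointwise (⊎-<-isPartialOrder V.isPartialOrder W.isPartialOrder)
  ; label          = [ V.label , W.label ]′
  }
  where module V = Pomset V
        module W = Pomset W

V ∥ₚ W = record
  { Node           = V.Node ⊎ W.Node
  ; finite         = ⊎-finite V.finite W.finite
  ; _≤_            = Pointwise V._≤_ W._≤_
  ; isPartialOrder = fromPointwise (⊎-isPartialOrder V.isPartialOrder W.isPartialOrder)
  ; label          = [ V.label , W.label ]′
  }
  where module V = Pomset V
        module W = Pomset W

data SP {A : Set} : Pred (Pomset A) (lsuc 0ℓ) where
  sp-≅      : ∀ {V W} → V ≅ W → SP W → SP V
  sp-empty  : SP empty
  sp-letter : ∀ a → SP (letter a)
  sp-·      : ∀ {V W} → SP V → SP W → SP (V ·ₚ W)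
  sp-∥      : ∀ {V W} → SP V → SP W → SP (V ∥ₚ W)

module _ (P : Pomset B) (k : B → Pomset A) where
  private
    module P = Pomset P
    K : P.Node → Pomset A
    K c = k (P.label c)
    module K c = Pomset (K c)

  SubstNode : Set
  SubstNode = Σ P.Node K.Node

  data SubstOrder : Rel SubstNode 0ℓ where
    outer : ∀ {c c′ i j} → c P.≤ c′ → c ≢ c′ → SubstOrder (c , i) (c′ , j)
    inner : ∀ {c i j} → K._≤_ c i j → SubstOrder (c , i) (c , j)

  private
    po : IsPartialOrder _≡_ SubstOrder
    po = record
      { isPreorder = record
        { isEquivalence = isEquivalence
        ; reflexive     = λ { {c , _} refl → inner (IsPartialOrder.refl (K.isPartialOrder c)) }
        ; trans         = tr
        }
      ; antisym = asym
      }
      where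
      module O = IsPartialOrder P.isPartialOrder
      tr : ∀ {u v w} → SubstOrder u v → SubstOrder v w → SubstOrder u w
      tr (outer p p≢) (outer q q≢) =
        outer (O.trans p q) λ { refl → p≢ (O.antisym p q) }
      tr (outer p p≢) (inner _)    = outer p p≢
      tr (inner _)    (outer q q≢) = outer q q≢
      tr (inner {c = c} p) (inner q) = inner (IsPartialOrder.trans (K.isPartialOrder c) p q)
      asym : ∀ {u v} → SubstOrder u v → SubstOrder v u → u ≡ v
      asym (outer p p≢) (outer q _) = ⊥-elim (p≢ (O.antisym p q))
      asym (outer _ p≢) (inner _)   = ⊥-elim (p≢ refl)
      asym (inner _)    (outer _ q≢) = ⊥-elim (q≢ refl)
      asym (inner {c = c} p) (inner q) =
        cong (c ,_) (IsPartialOrder.antisym (K.isPartialOrder c) p q)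

  -- Every node c of P is replaced by the pomset k (label c).
  substitute : Pomset A
  substitute = record
    { Node           = SubstNode
    ; finite         = Σ-finite P.finite K.finite
    ; _≤_            = SubstOrder
    ; isPartialOrder = po
    ; label          = λ (c , i) → K.label c i
    }

-- The extra letter * is nothing.
record PC (A : Set) : Set₁ where
  field
    pomset   : Pomset (Maybe A)
    isSP     : SP pomset
    one-hole : ∃! _≡_ λ c → Pomset.label pomset c ≡ nothing

infix 8 _⟨_⟩ _⟨_⟩ᴸ

_⟨_⟩ : PC A → Pomset A → Pomset A
C ⟨ V ⟩ = substitute (PC.pomset C) (maybe′ letter V)

-- Membership in SP is not built into Lang: the languages below are generated
-- from letters by · and ∥, and SP is needed only for contexts.

Lang : Set → Set₂
Lang A = Pred (Pomset A) (lsuc 0ℓ)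

⟪_⟫ : Pomset A → Lang A
⟪ V ⟫ W = Level.Lift _ (W ≅ V)

infixr 7 _·ᴸ_
infixr 6 _∥ᴸ_
infix  9 _^ᴸ_ _*ᴸ

_·ᴸ_ _∥ᴸ_ : Lang A → Lang A → Lang A
(L ·ᴸ M) X = ∃[ V ] ∃[ W ] V ∈ L × W ∈ M × X ≅ V ·ₚ W
(L ∥ᴸ M) X = ∃[ V ] ∃[ W ] V ∈ L × W ∈ M × X ≅ V ∥ₚ W

_^ᴸ_ : Lang A → ℕ → Lang A
L ^ᴸ zero  = ⟪ empty ⟫
L ^ᴸ suc n = L ·ᴸ L ^ᴸ n

_*ᴸ : Lang A → Lang A
(L *ᴸ) X = ∃[ n ] X ∈ L ^ᴸ n

_⟨_⟩ᴸ : PC A → Lang A → Lang A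
(C ⟨ L ⟩ᴸ) X = ∃[ V ] V ∈ L × X ≅ C ⟨ V ⟩

infix  9 ‵_
infix  8 _*
infixr 7 _·_
infixr 6 _∥_
infixr 5 _+_

data Exp (A : Set) : Set where
  𝟘 𝟙         : Exp A
  ‵_          : A → Exp A
  _+_ _·_ _∥_ : Exp A → Exp A → Exp A
  _*          : Exp A → Exp A

⟦_⟧BKA : Exp A → Lang A
⟦ 𝟘 ⟧BKA     = λ _ → Level.Lift _ ⊥
⟦ 𝟙 ⟧BKA     = ⟪ empty ⟫
⟦ ‵ a ⟧BKA   = ⟪ letter a ⟫
⟦ e + f ⟧BKA = ⟦ e ⟧BKA ∪ ⟦ f ⟧BKA
⟦ e · f ⟧BKA = ⟦ e ⟧BKA ·ᴸ ⟦ f ⟧BKA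
⟦ e ∥ f ⟧BKA = ⟦ e ⟧BKA ∥ᴸ ⟦ f ⟧BKA
⟦ e * ⟧BKA   = ⟦ e ⟧BKA *ᴸ

-- H e f means that the inequation e ≤ f belongs to H.
Hypotheses : Set → Set₁
Hypotheses A = Rel (Exp A) 0ℓ

infix 8 _↓[_]

data _↓[_] {A : Set} (L : Lang A) (H : Hypotheses A) : Lang A where
  base : L ⊆ L ↓[ H ]
  step : ∀ {e f} → H e f → (C : PC A) →
         C ⟨ ⟦ f ⟧BKA ⟩ᴸ ⊆ L ↓[ H ] → C ⟨ ⟦ e ⟧BKA ⟩ᴸ ⊆ L ↓[ H ]

Var Val : Set
Var = Fin 4
Val = Fin 2

-- x and y are called vx and vy: a pattern name cannot be reused as a variable.
pattern vx = 0F
pattern vy = 1F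
pattern r₀ = 2F
pattern r₁ = 3F

-- The graph of a partial function Var ⇀ Val: lookup α v is just n if
-- α(v) = n and nothing if α(v) is undefined.  A vector rather than a
-- function, so that _≡_ is equality of partial functions.
State : Set
State = Vec (Maybe Val) 4

infix 4 _∈dom_ _⊑_

_∈dom_ : Var → State → Set
v ∈dom α = ∃[ n ] lookup α v ≡ just n

_⊑_ : Rel State 0ℓ
α ⊑ β = (∀ v → v ∈dom β → v ∈dom α) × (∀ v → v ∈dom β → lookup α v ≡ lookup β v)

Compatible : Rel State 0ℓ
Compatible α β = ∀ v → v ∈dom α → v ∈dom β → lookup α v ≡ lookup β v

-- α ∪ β, meaningful for compatible α and β only.
infixr 8 _⊕_
_⊕_ : State → State → State
_⊕_ = zipWith _<∣>_

infix 9 _←_ _←ᵛ_ _≐_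

data Act : Set where
  _←_  : Var → Val → Act
  _←ᵛ_ : Var → Var → Act

-- α[a], nothing when it does not exist.
_[_] : State → Act → Maybe State
α [ v ← n ]   = just (α [ v ]≔ just n)
α [ v ←ᵛ v′ ] = Maybe.map (λ n → α [ v ]≔ just n) (lookup α v′)

data Obs : Set where
  _≐_ : Var → Val → Obs

infixr 7 _∧_
infixr 6 _∨_

data 𝒪 : Set where
  ⊥ₒ ⊤ₒ   : 𝒪
  obs     : Obs → 𝒪
  _∨_ _∧_ : 𝒪 → 𝒪 → 𝒪
  compl   : 𝒪 → 𝒪

record DownSet ℓ : Set (lsuc ℓ) where
  field
    member : Pred State ℓ
    closed : ∀ {α β} → α ⊑ β → β ∈ member → α ∈ member

open DownSet

-- The union in the last clause ranges over predicates Z at level 0 and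
-- therefore lives one level up.  No Z is lost by this: a downwards-closed
-- set of any level is a union of principal ones, which are at level 0.
⟦_⟧OA : 𝒪 → DownSet (lsuc 0ℓ)
⟦ ⊥ₒ ⟧OA = record { member = λ _ → Level.Lift _ ⊥ ; closed = λ _ z → z }
⟦ ⊤ₒ ⟧OA = record { member = λ _ → Level.Lift _ ⊤ ; closed = λ _ z → z }
⟦ obs (v ≐ n) ⟧OA = record
  { member = λ α → Level.Lift _ (lookup α v ≡ just n)
  ; closed = λ (_ , eq) (Level.lift e) → Level.lift (trans (eq v (n , e)) e) }
⟦ p ∨ q ⟧OA = record
  { member = member ⟦ p ⟧OA ∪ member ⟦ q ⟧OA
  ; closed = λ { le (inj₁ z) → inj₁ (closed ⟦ p ⟧OA le z)
               ; le (inj₂ z) → inj₂ (closed ⟦ q ⟧OA le z) } }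
⟦ p ∧ q ⟧OA = record
  { member = member ⟦ p ⟧OA ∩ member ⟦ q ⟧OA
  ; closed = λ le (z , w) → closed ⟦ p ⟧OA le z , closed ⟦ q ⟧OA le w }
⟦ compl p ⟧OA = record
  { member = λ α → Σ (DownSet 0ℓ) λ Z → Empty (member ⟦ p ⟧OA ∩ member Z) × α ∈ member Z
  ; closed = λ le (Z , disj , z) → Z , disj , closed Z le z }

Term : Set
Term = Exp (Act ⊎ 𝒪)

Alphabet : Set
Alphabet = Act ⊎ State

act : Act → Pomset Alphabet
act a = letter (inj₁ a)

state : State → Pomset Alphabet
state α = letter (inj₂ α)

states : Pred State (lsuc 0ℓ) → Lang Alphabet
states S X = ∃[ α ] α ∈ S × X ≅ state α

State* : Lang Alphabet
State* = states (λ _ → Level.Lift _ ⊤) *ᴸ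

⦅_⦆ : Term → Lang Alphabet
⦅ 𝟘 ⦆          = λ _ → Level.Lift _ ⊥
⦅ 𝟙 ⦆          = ⟪ empty ⟫
⦅ ‵ (inj₁ a) ⦆ = State* ·ᴸ ⟪ act a ⟫ ·ᴸ State*
⦅ ‵ (inj₂ p) ⦆ = State* ·ᴸ states (member ⟦ p ⟧OA) ·ᴸ State*
⦅ e + f ⦆      = ⦅ e ⦆ ∪ ⦅ f ⦆
⦅ e · f ⦆      = ⦅ e ⦆ ·ᴸ ⦅ f ⦆
⦅ e ∥ f ⦆      = ⦅ e ⦆ ∥ᴸ ⦅ f ⦆
⦅ e * ⦆        = ⦅ e ⦆ *ᴸ

data exch {A : Set} : Hypotheses A where
  exchange : ∀ e f g h → exch ((e ∥ f) · (g ∥ h)) ((e · g) ∥ (f · h))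

data contr : Hypotheses Alphabet where
  contract : ∀ α → contr (‵ inj₂ α) (‵ inj₂ α · ‵ inj₂ α)

⦅_⦆↓ : Term → Lang Alphabet
⦅ e ⦆↓ = ⦅ e ⦆ ↓[ exch ∪ᴿ contr ]

data 𝒢 : Lang Alphabet where
  𝒢-≅     : ∀ {V W} → V ≅ W → W ∈ 𝒢 → V ∈ 𝒢
  𝒢-state : ∀ α → state α ∈ 𝒢
  𝒢-act   : ∀ {α a β} → α [ a ] ≡ just β → state α ·ₚ act a ·ₚ state β ∈ 𝒢
  𝒢-seq   : ∀ {V W α} → V ·ₚ state α ∈ 𝒢 → state α ·ₚ W ∈ 𝒢 →
            V ·ₚ state α ·ₚ W ∈ 𝒢
  𝒢-par   : ∀ {V W α β γ δ} →
            state α ·ₚ V ·ₚ state β ∈ 𝒢 → state γ ·ₚ W ·ₚ state δ ∈ 𝒢 →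
            Compatible α γ → Compatible β δ →
            state (α ⊕ γ) ·ₚ (V ∥ₚ W) ·ₚ state (β ⊕ δ) ∈ 𝒢

t : Term
t =   ‵ inj₂ (obs (r₀ ≐ 0F) ∧ obs (r₁ ≐ 0F))
    · (  (‵ inj₁ (vx ← 1F) · ‵ inj₁ (r₀ ←ᵛ vy))
       ∥ (‵ inj₁ (vy ← 1F) · ‵ inj₁ (r₁ ←ᵛ vx)))
    · ‵ inj₂ (compl (obs (r₀ ≐ 1F) ∨ obs (r₁ ≐ 1F)))

-- An execution of t ends with r₀ = r₁ = 0.  In a guarded pomset where v and u
-- are each written once, by v ← u and by u ← n, a final value of v other than n
-- forces the read v ← u to lie below the write u ← n: states in sequence hand
-- over the value n, and states in parallel are compatible.  The two reads of t
-- therefore close the cycle  x←1 ≤ r₀←y ≤ y←1 ≤ r₁←x ≤ x←1.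
-- To find these nodes in every pomset of the closure, follow the image of the
-- fixed pomset  ((x←1 · r₀←y) ∥ (y←1 · r₁←x)) · φ  under monotone maps: closure
-- under exch and contr only adds order or identifies equal states.
module Submission where

open import Defs
open import Data.Empty using (⊥-elim)
open import Data.Fin.Patterns using (0F; 1F)
open import Data.Fin.Properties using (_≟_)
open import Data.Maybe using (just; nothing; _<∣>_; maybe′)
open import Data.Nat using (suc)
open import Data.Product using (∃-syntax; _×_; _,_; proj₁; proj₂)
open import Data.Sum using (inj₁; inj₂)
import Data.Sum as Sum
open import Data.Sum.Properties using (inj₂-injective)
open import Data.Sum.Relation.Binary.LeftOrder using (₁∼₁; ₁∼₂; ₂∼₂)
open import Data.Sum.Relation.Binary.Pointwise using (inj₁; inj₂)
open import Data.Unit using (tt)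
open import Data.Vec using (lookup; _[_]≔_)
open import Data.Vec.Properties using (lookup∘update; lookup∘update′; lookup-zipWith)
open import Function using (_∘_; id; Equivalence; Inverse)
open import Function.Properties.Equivalence using () renaming (refl to ⇔-refl)
open import Function.Properties.Inverse using (↔-refl)
open import Level using (0ℓ; lift)
open import Relation.Binary.Core using (Rel)
open import Relation.Binary.Construct.Union using () renaming (_∪_ to _∪ᴿ_)
open import Relation.Binary.PropositionalEquality
  using (_≡_; _≢_; refl; sym; trans; cong; cong₂; subst; subst₂)
open import Relation.Binary.Structures using (IsPartialOrder)
open import Relation.Nullary using (yes; no; contradiction)
open import Relation.Unary using (Empty; _∩_; _∈_)

open Pomset using (Node; label)

private
  variable
    A : Set
    V V′ W W′ X : Pomset Alphabet
    α β γ δ σ : State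
    a : Act
    v u : Var
    n : Val

-- Order and isomorphism of labelled posets.

infix 4 _⊢_≤_

_⊢_≤_ : (X : Pomset A) → Rel (Node X) 0ℓ
X ⊢ k ≤ l = Pomset._≤_ X k l

≤-refl : (X : Pomset A) {k : Node X} → X ⊢ k ≤ k
≤-refl X = IsPartialOrder.refl (Pomset.isPartialOrder X)

≤-trans : (X : Pomset A) {k l m : Node X} → X ⊢ k ≤ l → X ⊢ l ≤ m → X ⊢ k ≤ m
≤-trans X = IsPartialOrder.trans (Pomset.isPartialOrder X)

≤-antisym : (X : Pomset A) {k l : Node X} → X ⊢ k ≤ l → X ⊢ l ≤ k → k ≡ l
≤-antisym X = IsPartialOrder.antisym (Pomset.isPartialOrder X)

≅-refl : X ≅ X
≅-refl = record
  { bijection = ↔-refl ; label-≡ = λ _ → refl ; order = λ _ _ → ⇔-refl }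

label-from : (i : V ≅ W) (w : Node W) → label V (_≅_.from i w) ≡ label W w
label-from {W = W} i w =
  trans (sym (_≅_.label-≡ i _)) (cong (label W) (Inverse.strictlyInverseˡ (_≅_.bijection i) w))

-- Monotone maps that hit every action

infix 4 _⇝_

-- `cover` asks only for actions: every letter of a term is padded with arbitrary states, whereas an
-- extra action could write a variable again. Maps may merge nodes, since contraction identifies two
-- equal states.
record _⇝_ (V W : Pomset Alphabet) : Set where
  field
    fun     : Node V → Node W
    label-≡ : ∀ k → label W (fun k) ≡ label V k
    mono    : ∀ {k l} → V ⊢ k ≤ l → W ⊢ fun k ≤ fun l
    cover   : ∀ w {a} → label W w ≡ inj₁ a → ∃[ k ] fun k ≡ w

open _⇝_

⇝-refl : X ⇝ X
⇝-refl = record { fun = id ; label-≡ = λ _ → refl ; mono = id ; cover = λ w _ → w , refl }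

⇝-trans : V ⇝ W → W ⇝ X → V ⇝ X
⇝-trans {X = X} f g = record
  { fun     = fun g ∘ fun f
  ; label-≡ = λ k → trans (label-≡ g (fun f k)) (label-≡ f k)
  ; mono    = mono g ∘ mono f
  ; cover   = λ x eq → let w , gw = cover g x eq
                           k , fk = cover f w
                                      (trans (sym (label-≡ g w)) (trans (cong (label X) gw) eq))
                       in  k , trans (cong (fun g) fk) gw
  }

-- Languages give an isomorphism from a member to a composed pomset, while the maps run towards the
-- member; hence the reversed direction.
≅⇒⇜ : V ≅ W → W ⇝ V
≅⇒⇜ {V} {W} i = record
  { fun     = I.from
  ; label-≡ = label-from i
  ; mono    = λ {k} {l} p → Equivalence.from (I.order _ _)
                (subst₂ (W ⊢_≤_) (sym (inv k)) (sym (inv l)) p)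
  ; cover   = λ v _ → I.to v , Inverse.strictlyInverseʳ I.bijection v
  }
  where
  module I = _≅_ i
  inv = Inverse.strictlyInverseˡ I.bijection

·-mono : V ⇝ V′ → W ⇝ W′ → V ·ₚ W ⇝ V′ ·ₚ W′
·-mono f g = record
  { fun     = Sum.map (fun f) (fun g)
  ; label-≡ = λ { (inj₁ k) → label-≡ f k ; (inj₂ k) → label-≡ g k }
  ; mono    = λ { (₁∼₁ p) → ₁∼₁ (mono f p) ; ₁∼₂ → ₁∼₂ ; (₂∼₂ p) → ₂∼₂ (mono g p) }
  ; cover   = λ { (inj₁ w) eq → let k , e = cover f w eq in inj₁ k , cong inj₁ e
                ; (inj₂ w) eq → let k , e = cover g w eq in inj₂ k , cong inj₂ e }
  }

∥-mono : V ⇝ V′ → W ⇝ W′ → V ∥ₚ W ⇝ V′ ∥ₚ W′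
∥-mono f g = record
  { fun     = Sum.map (fun f) (fun g)
  ; label-≡ = λ { (inj₁ k) → label-≡ f k ; (inj₂ k) → label-≡ g k }
  ; mono    = λ { (inj₁ p) → inj₁ (mono f p) ; (inj₂ p) → inj₂ (mono g p) }
  ; cover   = λ { (inj₁ w) eq → let k , e = cover f w eq in inj₁ k , cong inj₁ e
                ; (inj₂ w) eq → let k , e = cover g w eq in inj₂ k , cong inj₂ e }
  }

-- empty ⇝ V says that V has no actions.
·-skipˡ : empty ⇝ V → W ⇝ W′ → W ⇝ V ·ₚ W′
·-skipˡ f g = record
  { fun     = inj₂ ∘ fun g
  ; label-≡ = label-≡ g
  ; mono    = ₂∼₂ ∘ mono g
  ; cover   = λ { (inj₁ v) eq → ⊥-elim (proj₁ (cover f v eq))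
                ; (inj₂ w) eq → let k , e = cover g w eq in k , cong inj₂ e }
  }

·-skipʳ : V ⇝ V′ → empty ⇝ W → V ⇝ V′ ·ₚ W
·-skipʳ f g = record
  { fun     = inj₁ ∘ fun f
  ; label-≡ = label-≡ f
  ; mono    = ₁∼₁ ∘ mono f
  ; cover   = λ { (inj₁ v) eq → let k , e = cover f v eq in k , cong inj₁ e
                ; (inj₂ w) eq → ⊥-elim (proj₁ (cover g w eq)) }
  }

empty⇝state : empty ⇝ state α
empty⇝state = record
  { fun = λ () ; label-≡ = λ () ; mono = λ { {()} } ; cover = λ _ () }

-- The closure rules as monotone maps.

·⇝contract : state α ·ₚ state α ⇝ state α
·⇝contract = record
  { fun     = λ _ → tt
  ; label-≡ = λ { (inj₁ _) → refl ; (inj₂ _) → refl }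
  ; mono    = λ _ → refl
  ; cover   = λ _ ()
  }

-- A regrouping of the same nodes. The order within each parallel branch survives; the pairs from
-- `E` to `H` and from `F` to `G` are new in the target.
∥⇝exchange : ∀ E F G H → (E ·ₚ G) ∥ₚ (F ·ₚ H) ⇝ (E ∥ₚ F) ·ₚ (G ∥ₚ H)
∥⇝exchange E F G H = record
  { fun     = λ { (inj₁ (inj₁ k)) → inj₁ (inj₁ k) ; (inj₁ (inj₂ k)) → inj₂ (inj₁ k)
                ; (inj₂ (inj₁ k)) → inj₁ (inj₂ k) ; (inj₂ (inj₂ k)) → inj₂ (inj₂ k) }
  ; label-≡ = λ { (inj₁ (inj₁ _)) → refl ; (inj₁ (inj₂ _)) → refl
                ; (inj₂ (inj₁ _)) → refl ; (inj₂ (inj₂ _)) → refl }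
  ; mono    = λ { (inj₁ (₁∼₁ p)) → ₁∼₁ (inj₁ p) ; (inj₁ ₁∼₂) → ₁∼₂
                ; (inj₁ (₂∼₂ p)) → ₂∼₂ (inj₁ p)
                ; (inj₂ (₁∼₁ p)) → ₁∼₁ (inj₂ p) ; (inj₂ ₁∼₂) → ₁∼₂
                ; (inj₂ (₂∼₂ p)) → ₂∼₂ (inj₂ p) }
  ; cover   = λ { (inj₁ (inj₁ k)) _ → inj₁ (inj₁ k) , refl
                ; (inj₁ (inj₂ k)) _ → inj₂ (inj₁ k) , refl
                ; (inj₂ (inj₁ k)) _ → inj₁ (inj₂ k) , refl
                ; (inj₂ (inj₂ k)) _ → inj₂ (inj₂ k) , refl }
  }

-- Nodes of the context stay in place, so the order between distinct ones carries over; `f` acts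
-- only inside the hole.
context-mono : (C : PC Alphabet) → V ⇝ W → C ⟨ V ⟩ ⇝ C ⟨ W ⟩
context-mono {V} {W} C f = record
  { fun     = λ (c , i) → c , fun (at (label P c)) i
  ; label-≡ = λ (c , i) → label-≡ (at (label P c)) i
  ; mono    = λ { (outer p p≢)     → outer p p≢
                ; (inner {c = c} p) → inner (mono (at (label P c)) p) }
  ; cover   = λ (c , i) eq → let k , e = cover (at (label P c)) i eq in (c , k) , cong (c ,_) e
  }
  where
  P = PC.pomset C
  at : ∀ b → maybe′ letter V b ⇝ maybe′ letter W b
  at (just _) = ⇝-refl
  at nothing  = f

-- The map runs against the inequation: closure passes from words of `f` to words of `e`, so the
-- older pomset is the source.
hypothesis⇝ : ∀ {e f} → (exch ∪ᴿ contr) e f → W ∈ ⟦ e ⟧BKA → ∃[ V ] V ∈ ⟦ f ⟧BKA × V ⇝ W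
hypothesis⇝ {W} (inj₁ (exchange e f g h))
  (Y , Z , (E , F , E∈ , F∈ , Y≅) , (G , H , G∈ , H∈ , Z≅) , W≅) =
    (E ·ₚ G) ∥ₚ (F ·ₚ H)
  , (_ , _ , (E , G , E∈ , G∈ , ≅-refl) , (F , H , F∈ , H∈ , ≅-refl) , ≅-refl)
  , ⇝-trans (∥⇝exchange E F G H) (⇝-trans (·-mono (≅⇒⇜ Y≅) (≅⇒⇜ Z≅)) (≅⇒⇜ W≅))
hypothesis⇝ {W} (inj₂ (contract α)) (lift W≅) =
  state α ·ₚ state α , (_ , _ , lift ≅-refl , lift ≅-refl , ≅-refl) , ⇝-trans ·⇝contract (≅⇒⇜ W≅)

closure⇝ : ∀ {L} → X ∈ L ↓[ exch ∪ᴿ contr ] → ∃[ V ] V ∈ L × V ⇝ X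
closure⇝ (base X∈L) = _ , X∈L , ⇝-refl
closure⇝ (step h C C⟨f⟩⊆ (W , W∈e , X≅)) =
  -- The premise speaks of every word of `f`; the recursive call takes the one that maps to `W`,
  -- placed in the context.
  let V , V∈f , V⇝W = hypothesis⇝ h W∈e
      Y , Y∈L , Y⇝C = closure⇝ (C⟨f⟩⊆ (V , V∈f , ≅-refl))
  in  Y , Y∈L , ⇝-trans Y⇝C (⇝-trans (context-mono C V⇝W) (≅⇒⇜ X≅))

-- The skeleton of t

skeleton : State → Pomset Alphabet
skeleton φ =
  ((act (vx ← 1F) ·ₚ act (r₀ ←ᵛ vy)) ∥ₚ (act (vy ← 1F) ·ₚ act (r₁ ←ᵛ vx))) ·ₚ state φ

State*-no-actions : X ∈ State* → empty ⇝ X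
State*-no-actions (m , X∈) = go m X∈
  where
  go : ∀ {X} m → X ∈ states _ ^ᴸ m → empty ⇝ X
  go 0 (lift X≅) = ≅⇒⇜ X≅
  go (suc m) (V , W , (α , _ , V≅) , W∈ , X≅) =
    ⇝-trans (·-skipˡ (⇝-trans (empty⇝state {α}) (≅⇒⇜ V≅)) (go m W∈)) (≅⇒⇜ X≅)

act⇝ : ∀ a → X ∈ ⦅ ‵ inj₁ a ⦆ → act a ⇝ X
act⇝ a (S , _ , S∈ , (_ , S′ , lift A≅ , S′∈ , Z≅) , X≅) =
  ⇝-trans
    (·-skipˡ (State*-no-actions S∈)
      (⇝-trans (·-skipʳ (≅⇒⇜ A≅) (State*-no-actions S′∈)) (≅⇒⇜ Z≅)))
    (≅⇒⇜ X≅)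

state⇝ : ∀ p → X ∈ ⦅ ‵ inj₂ p ⦆ → ∃[ α ] α ∈ DownSet.member ⟦ p ⟧OA × state α ⇝ X
state⇝ p (S , _ , S∈ , (_ , S′ , (α , α∈ , A≅) , S′∈ , Z≅) , X≅) =
  α , α∈ , ⇝-trans
    (·-skipˡ (State*-no-actions S∈)
      (⇝-trans (·-skipʳ (≅⇒⇜ A≅) (State*-no-actions S′∈)) (≅⇒⇜ Z≅)))
    (≅⇒⇜ X≅)

act·act⇝ : ∀ a b → X ∈ ⦅ ‵ inj₁ a · ‵ inj₁ b ⦆ → act a ·ₚ act b ⇝ X
act·act⇝ a b (_ , _ , V∈ , W∈ , X≅) = ⇝-trans (·-mono (act⇝ a V∈) (act⇝ b W∈)) (≅⇒⇜ X≅)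

-- More defined states are lower in `⊑`, so agreement is asked on the domain of `α` alone, which
-- does not contain `v`.
≔-⊑ : ∀ α v n → lookup α v ≡ nothing → α [ v ]≔ just n ⊑ α
≔-⊑ α v n αv = (λ u u∈ → proj₁ u∈ , trans (agree u u∈) (proj₂ u∈)) , agree
  where
  agree : ∀ u → u ∈dom α → lookup (α [ v ]≔ just n) u ≡ lookup α u
  agree u (_ , αu) with u ≟ v
  ... | yes refl = contradiction (trans (sym αv) αu) λ ()
  ... | no u≢v   = lookup∘update′ u≢v α _

-- The pseudocomplement also excludes undefined values, since an undefined
-- variable can be given the value 1 below α.
never-1⇒0 : ∀ α v → (∀ β → β ⊑ α → lookup β v ≢ just 1F) → lookup α v ≡ just 0F
never-1⇒0 α v never with lookup α v in αv
... | just 0F = refl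
... | just 1F = contradiction αv (never α ((λ _ → id) , λ _ _ → refl))
... | nothing = contradiction (lookup∘update v α (just 1F))
                  (never (α [ v ]≔ just 1F) (≔-⊑ α v 1F αv))

-- The down-set `Z` contains everything below `α` and is disjoint from the test, so no refinement of
-- `α` gives either register the value 1.
final-zeros : ∀ α → α ∈ DownSet.member ⟦ compl (obs (r₀ ≐ 1F) ∨ obs (r₁ ≐ 1F)) ⟧OA →
              lookup α r₀ ≡ just 0F × lookup α r₁ ≡ just 0F
final-zeros α (Z , disjoint , α∈Z) =
    never-1⇒0 α r₀ (λ β β⊑α e → disjoint β (inj₁ (lift e) , DownSet.closed Z β⊑α α∈Z))
  , never-1⇒0 α r₁ (λ β β⊑α e → disjoint β (inj₂ (lift e) , DownSet.closed Z β⊑α α∈Z))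

skeleton⇝ : X ∈ ⦅ t ⦆ → ∃[ φ ] (lookup φ r₀ ≡ just 0F × lookup φ r₁ ≡ just 0F) × skeleton φ ⇝ X
skeleton⇝ (I , _ , I∈ , (_ , F , (_ , _ , V∈ , W∈ , P≅) , F∈ , Y≅) , X≅) =
  let _ , _ , i = state⇝ (obs (r₀ ≐ 0F) ∧ obs (r₁ ≐ 0F)) I∈
      φ , φ∈ , f = state⇝ (compl (obs (r₀ ≐ 1F) ∨ obs (r₁ ≐ 1F))) F∈
      p = ∥-mono (act·act⇝ (vx ← 1F) (r₀ ←ᵛ vy) V∈) (act·act⇝ (vy ← 1F) (r₁ ←ᵛ vx) W∈)
  in  φ , final-zeros φ φ∈ ,
      ⇝-trans
        (·-skipˡ (⇝-trans empty⇝state i)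
          (⇝-trans (·-mono (⇝-trans p (≅⇒⇜ P≅)) f) (≅⇒⇜ Y≅)))
        (≅⇒⇜ X≅)

-- Guarded pomsets as runs

-- `𝒢` with the first and last state as indices, which an isomorphism leaves unchanged. Claims about
-- initial and final values then go by induction.
data Run : State → Pomset Alphabet → State → Set₁ where
  run-iso   : V ≅ W → Run α W β → Run α V β
  run-state : ∀ α → Run α (state α) α
  run-act   : α [ a ] ≡ just β → Run α (state α ·ₚ act a ·ₚ state β) β
  run-seq   : ∀ V β W → Run α (V ·ₚ state β) β → Run β (state β ·ₚ W) γ →
              Run α (V ·ₚ state β ·ₚ W) γ
  run-par   : ∀ α V β γ W δ →
              Run α (state α ·ₚ V ·ₚ state β) β → Run γ (state γ ·ₚ W ·ₚ state δ) δ →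
              Compatible α γ → Compatible β δ →
              Run (α ⊕ γ) (state (α ⊕ γ) ·ₚ (V ∥ₚ W) ·ₚ state (β ⊕ δ)) (β ⊕ δ)

-- A least node is preserved by isomorphism, so it recovers the start state from any presentation of
-- the pomset.
run-least : Run α X β → ∃[ m ] (∀ k → X ⊢ m ≤ k) × label X m ≡ inj₂ α
run-least (run-iso {V = V} {W = W} i ρ) =
  let m , m≤ , eq = run-least ρ
  in  fun (≅⇒⇜ i) m
    , (λ k → subst (V ⊢ _ ≤_) (Inverse.strictlyInverseʳ (_≅_.bijection i) k)
               (mono (≅⇒⇜ i) (m≤ (_≅_.to i k))))
    , trans (label-from i m) eq
run-least (run-state α) = tt , (λ _ → refl) , refl
run-least (run-act _)  = inj₁ tt , (λ { (inj₁ _) → ₁∼₁ refl ; (inj₂ _) → ₁∼₂ }) , refl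
run-least (run-seq V _ _ ρ _) with run-least ρ
... | inj₁ m , m≤ , eq = inj₁ m , (λ { (inj₁ k) → ₁∼₁ (below k) ; (inj₂ _) → ₁∼₂ }) , eq
  where
  below : ∀ k → V ⊢ m ≤ k
  below k with ₁∼₁ p ← m≤ (inj₁ k) = p
-- The least node is the joining state, so `V` has no nodes: any of them would lie below it and
-- never above.
... | inj₂ tt , m≤ , eq =
  inj₂ (inj₁ tt)
  , (λ { (inj₁ k) → contradiction (m≤ (inj₁ k)) λ ()
       ; (inj₂ (inj₁ _)) → ₂∼₂ (₁∼₁ refl) ; (inj₂ (inj₂ _)) → ₂∼₂ ₁∼₂ })
  , eq
run-least (run-par _ _ _ _ _ _ _ _ _ _) =
  inj₁ tt , (λ { (inj₁ _) → ₁∼₁ refl ; (inj₂ _) → ₁∼₂ }) , refl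

run-greatest : Run α X β → ∃[ m ] (∀ k → X ⊢ k ≤ m) × label X m ≡ inj₂ β
run-greatest (run-iso {V = V} i ρ) =
  let m , ≤m , eq = run-greatest ρ
  in  fun (≅⇒⇜ i) m
    , (λ k → subst (V ⊢_≤ _) (Inverse.strictlyInverseʳ (_≅_.bijection i) k)
               (mono (≅⇒⇜ i) (≤m (_≅_.to i k))))
    , trans (label-from i m) eq
run-greatest (run-state α) = tt , (λ _ → refl) , refl
run-greatest (run-act _)  =
  inj₂ (inj₂ tt)
  , (λ { (inj₁ _) → ₁∼₂ ; (inj₂ (inj₁ _)) → ₂∼₂ ₁∼₂ ; (inj₂ (inj₂ _)) → ₂∼₂ (₂∼₂ refl) })
  , refl
run-greatest (run-seq _ _ _ _ ρ) with run-greatest ρ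
... | m , ≤m , eq = inj₂ m , (λ { (inj₁ _) → ₁∼₂ ; (inj₂ k) → ₂∼₂ (≤m k) }) , eq
run-greatest (run-par _ _ _ _ _ _ _ _ _ _) =
  inj₂ (inj₂ tt)
  , (λ { (inj₁ _) → ₁∼₂ ; (inj₂ (inj₁ _)) → ₂∼₂ ₁∼₂ ; (inj₂ (inj₂ _)) → ₂∼₂ (₂∼₂ refl) })
  , refl

-- The leading state is below all of `V` and never above, so the least node is that state and its
-- label determines `α`.
run-start : ∀ γ V → Run α (state γ ·ₚ V) β → α ≡ γ
run-start γ V ρ with run-least ρ
... | inj₁ _ , _ , eq = inj₂-injective (sym eq)
... | inj₂ _ , m≤ , _ = contradiction (m≤ (inj₁ tt)) λ ()

run-end : ∀ V γ → Run α (V ·ₚ state γ) β → β ≡ γ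
run-end V γ ρ with run-greatest ρ
... | inj₂ _ , _ , eq = inj₂-injective (sym eq)
... | inj₁ _ , ≤m , _ = contradiction (≤m (inj₂ tt)) λ ()

run-end₂ : ∀ W V γ → Run α (W ·ₚ V ·ₚ state γ) β → β ≡ γ
run-end₂ W V γ ρ with run-greatest ρ
... | inj₁ _ , ≤m , _        = contradiction (≤m (inj₂ (inj₂ tt))) λ ()
... | inj₂ (inj₁ _) , ≤m , _ = contradiction (≤m (inj₂ (inj₂ tt))) λ { (₂∼₂ ()) }
... | inj₂ (inj₂ _) , _ , eq = inj₂-injective (sym eq)

-- The inductive runs come with unknown indices; the states displayed in the pomsets pin these down,
-- which lets runs be composed.
𝒢⇒run : X ∈ 𝒢 → ∃[ α ] ∃[ β ] Run α X β
𝒢⇒run (𝒢-≅ i g) = let _ , _ , ρ = 𝒢⇒run g in _ , _ , run-iso i ρ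
𝒢⇒run (𝒢-state α) = α , α , run-state α
𝒢⇒run (𝒢-act eq) = _ , _ , run-act eq
𝒢⇒run (𝒢-seq {V} {W} {α} g h) with 𝒢⇒run g | 𝒢⇒run h
... | _ , _ , ρ | _ , _ , θ with refl ← run-end V α ρ | refl ← run-start α W θ =
  _ , _ , run-seq V α W ρ θ
𝒢⇒run (𝒢-par {V} {W} {α} {β} {γ} {δ} g h c d) with 𝒢⇒run g | 𝒢⇒run h
... | _ , _ , ρ | _ , _ , θ
  with refl ← run-start α (V ·ₚ state β) ρ | refl ← run-end₂ (state α) V β ρ
     | refl ← run-start γ (W ·ₚ state δ) θ | refl ← run-end₂ (state γ) W δ θ =
  _ , _ , run-par α V β γ W δ ρ θ c d

-- Values of variables along a run

target : Act → Var
target (v ← _)  = v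
target (v ←ᵛ _) = v

Unwritten : Pomset Alphabet → Var → Set
Unwritten X v = ∀ k {a} → label X k ≡ inj₁ a → target a ≢ v

-- Uniqueness of the writer only; that `k` does write `v` is supplied separately by its label.
WrittenOnlyAt : (X : Pomset Alphabet) → Var → Node X → Set
WrittenOnlyAt X v k = ∀ l {a} → label X l ≡ inj₁ a → target a ≡ v → l ≡ k

AboveActions : (X : Pomset Alphabet) → Node X → Set
AboveActions X s = ∀ k {a} → label X k ≡ inj₁ a → X ⊢ k ≤ s

-- Only the labels of actions need to be preserved: in a parallel composition
-- the end points of the components carry other states than those of the whole.
infix 4 _↪_

record _↪_ (V W : Pomset Alphabet) : Set where
  field
    embed   : Node V → Node W
    action  : ∀ k {a} → label V k ≡ inj₁ a → label W (embed k) ≡ inj₁ a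
    embed-≤ : ∀ {k l} → V ⊢ k ≤ l → W ⊢ embed k ≤ embed l
    reflect : ∀ {k l} → W ⊢ embed k ≤ embed l → V ⊢ k ≤ l

  injective : ∀ {k l} → embed k ≡ embed l → k ≡ l
  injective {k} eq = ≤-antisym V (reflect (subst (W ⊢ embed k ≤_) eq (≤-refl W)))
                             (reflect (subst (W ⊢_≤ embed k) eq (≤-refl W)))

  unwritten : Unwritten W v → Unwritten V v
  unwritten un k eq = un (embed k) (action k eq)

  written-elsewhere : ∀ {k} → WrittenOnlyAt W v k → (∀ l → embed l ≢ k) → Unwritten V v
  written-elsewhere only ≢k l eq ta = ≢k l (only (embed l) (action l eq) ta)

  written-only : ∀ {k} → WrittenOnlyAt W v (embed k) → WrittenOnlyAt V v k
  written-only only l eq ta = injective (only (embed l) (action l eq) ta)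

  above-actions : ∀ {s} → AboveActions W (embed s) → AboveActions V s
  above-actions above k eq = reflect (above (embed k) (action k eq))

≅⇒↩ : V ≅ W → W ↪ V
≅⇒↩ {V} {W} i = record
  { embed   = _≅_.from i
  ; action  = λ w eq → trans (label-from i w) eq
  ; embed-≤ = mono (≅⇒⇜ i)
  ; reflect = λ p → subst₂ (W ⊢_≤_) (inv _) (inv _) (Equivalence.to (_≅_.order i _ _) p)
  }
  where inv = Inverse.strictlyInverseˡ (_≅_.bijection i)

-- The images of `seqˡ` and `seqʳ` share just the middle state. Nodes of `V` are missed by `seqʳ`
-- and those of `W` by `seqˡ`, as `written-elsewhere` requires.
seqˡ : ∀ V α W → V ·ₚ state α ↪ V ·ₚ state α ·ₚ W
seqˡ V α W = record
  { embed   = λ { (inj₁ k) → inj₁ k ; (inj₂ k) → inj₂ (inj₁ k) }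
  ; action  = λ { (inj₁ _) eq → eq ; (inj₂ _) () }
  ; embed-≤ = λ { (₁∼₁ p) → ₁∼₁ p ; ₁∼₂ → ₁∼₂ ; (₂∼₂ p) → ₂∼₂ (₁∼₁ p) }
  ; reflect = λ { {inj₁ _} {inj₁ _} (₁∼₁ p) → ₁∼₁ p ; {inj₁ _} {inj₂ _} _ → ₁∼₂
                ; {inj₂ _} {inj₂ _} _ → ₂∼₂ refl }
  }

seqʳ : ∀ V α W → state α ·ₚ W ↪ V ·ₚ state α ·ₚ W
seqʳ V α W = record
  { embed = inj₂ ; action = λ _ → id ; embed-≤ = ₂∼₂ ; reflect = λ { (₂∼₂ p) → p } }

parˡ : ∀ α V β γ W δ →
       state α ·ₚ V ·ₚ state β ↪ state (α ⊕ γ) ·ₚ (V ∥ₚ W) ·ₚ state (β ⊕ δ)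
parˡ α V β γ W δ = record
  { embed   = Sum.map₂ (Sum.map₁ inj₁)
  ; action  = λ { (inj₁ _) () ; (inj₂ (inj₁ _)) eq → eq ; (inj₂ (inj₂ _)) () }
  ; embed-≤ = λ { (₁∼₁ p) → ₁∼₁ p ; ₁∼₂ → ₁∼₂ ; (₂∼₂ (₁∼₁ p)) → ₂∼₂ (₁∼₁ (inj₁ p))
                ; (₂∼₂ ₁∼₂) → ₂∼₂ ₁∼₂ ; (₂∼₂ (₂∼₂ p)) → ₂∼₂ (₂∼₂ p) }
  ; reflect = λ { {inj₁ _} {inj₁ _} _ → ₁∼₁ refl ; {inj₁ _} {inj₂ _} _ → ₁∼₂
                ; {inj₂ (inj₁ _)} {inj₂ (inj₁ _)} (₂∼₂ (₁∼₁ (inj₁ p))) → ₂∼₂ (₁∼₁ p)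
                ; {inj₂ (inj₁ _)} {inj₂ (inj₂ _)} _ → ₂∼₂ ₁∼₂
                ; {inj₂ (inj₂ _)} {inj₂ (inj₁ _)} (₂∼₂ ())
                ; {inj₂ (inj₂ _)} {inj₂ (inj₂ _)} _ → ₂∼₂ (₂∼₂ refl) }
  }

parʳ : ∀ α V β γ W δ →
       state γ ·ₚ W ·ₚ state δ ↪ state (α ⊕ γ) ·ₚ (V ∥ₚ W) ·ₚ state (β ⊕ δ)
parʳ α V β γ W δ = record
  { embed   = Sum.map₂ (Sum.map₁ inj₂)
  ; action  = λ { (inj₁ _) () ; (inj₂ (inj₁ _)) eq → eq ; (inj₂ (inj₂ _)) () }
  ; embed-≤ = λ { (₁∼₁ p) → ₁∼₁ p ; ₁∼₂ → ₁∼₂ ; (₂∼₂ (₁∼₁ p)) → ₂∼₂ (₁∼₁ (inj₂ p))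
                ; (₂∼₂ ₁∼₂) → ₂∼₂ ₁∼₂ ; (₂∼₂ (₂∼₂ p)) → ₂∼₂ (₂∼₂ p) }
  ; reflect = λ { {inj₁ _} {inj₁ _} _ → ₁∼₁ refl ; {inj₁ _} {inj₂ _} _ → ₁∼₂
                ; {inj₂ (inj₁ _)} {inj₂ (inj₁ _)} (₂∼₂ (₁∼₁ (inj₂ p))) → ₂∼₂ (₁∼₁ p)
                ; {inj₂ (inj₁ _)} {inj₂ (inj₂ _)} _ → ₂∼₂ ₁∼₂
                ; {inj₂ (inj₂ _)} {inj₂ (inj₁ _)} (₂∼₂ ())
                ; {inj₂ (inj₂ _)} {inj₂ (inj₂ _)} _ → ₂∼₂ (₂∼₂ refl) }
  }

open _↪_ using (unwritten; written-elsewhere; written-only; above-actions)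

≅-written-only : (i : V ≅ W) → ∀ {k} → WrittenOnlyAt V v k → WrittenOnlyAt W v (_≅_.to i k)
≅-written-only {V} {v = v} i {k} only = written-only (≅⇒↩ i)
  (subst (WrittenOnlyAt V v) (sym (Inverse.strictlyInverseʳ (_≅_.bijection i) k)) only)

≅-above-actions : (i : V ≅ W) → ∀ {s} → AboveActions V s → AboveActions W (_≅_.to i s)
≅-above-actions {V} i {s} above = above-actions (≅⇒↩ i)
  (subst (AboveActions V) (sym (Inverse.strictlyInverseʳ (_≅_.bijection i) s)) above)

-- Values in unions of states, after actions and at the end of runs.

⊕-left : ∀ α γ → lookup α v ≡ just n → lookup (α ⊕ γ) v ≡ just n
⊕-left {v} α γ αv = trans (lookup-zipWith _<∣>_ v α γ) (cong (_<∣> _) αv)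

⊕-right : ∀ α γ → Compatible α γ → lookup γ v ≡ just n → lookup (α ⊕ γ) v ≡ just n
⊕-right {v} α γ c γv with lookup α v in αv
-- `_<∣>_` takes the left value; compatibility makes it the value of `γ`.
... | just m  = trans (⊕-left α γ αv) (trans (sym αv) (trans (c v (_ , αv) (_ , γv)) γv))
... | nothing = trans (lookup-zipWith _<∣>_ v α γ) (trans (cong (_<∣> _) αv) γv)

act-elsewhere : ∀ a → α [ a ] ≡ just β → target a ≢ v → lookup α v ≡ lookup β v
act-elsewhere {α} (u ← n) refl u≢v = sym (lookup∘update′ (u≢v ∘ sym) α _)
act-elsewhere {α} (u ←ᵛ u′) eq u≢v with lookup α u′
act-elsewhere {α} (u ←ᵛ u′) refl u≢v | just n = sym (lookup∘update′ (u≢v ∘ sym) α _)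

copy-value : ∀ α → α [ v ←ᵛ u ] ≡ just β → ∃[ n ] lookup α u ≡ just n × lookup β v ≡ just n
copy-value {v} {u} α eq with lookup α u
copy-value {v} α refl | just n = n , refl , lookup∘update v α (just n)

-- The equality is between `Maybe` values, so undefinedness is preserved too. Otherwise the
-- left-biased `_⊕_` could switch components between the two ends of a parallel run.
unwritten-constant : Run α X β → Unwritten X v → lookup α v ≡ lookup β v
unwritten-constant (run-iso i ρ) un = unwritten-constant ρ (unwritten (≅⇒↩ i) un)
unwritten-constant (run-state _) _ = refl
unwritten-constant (run-act {a = a} eq) un = act-elsewhere a eq (un (inj₂ (inj₁ tt)) refl)
unwritten-constant (run-seq V μ W ρ θ) un =
  trans (unwritten-constant ρ (unwritten (seqˡ V μ W) un))
        (unwritten-constant θ (unwritten (seqʳ V μ W) un))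
unwritten-constant {v = v} (run-par α V β γ W δ ρ θ _ _) un =
  trans (lookup-zipWith _<∣>_ v α γ)
    (trans (cong₂ _<∣>_ (unwritten-constant ρ (unwritten (parˡ α V β γ W δ) un))
                        (unwritten-constant θ (unwritten (parʳ α V β γ W δ) un)))
           (sym (lookup-zipWith _<∣>_ v β δ)))

parˡ-misses : ∀ α V β γ W δ {w} l → _↪_.embed (parˡ α V β γ W δ) l ≢ inj₂ (inj₁ (inj₂ w))
parˡ-misses α V β γ W δ (inj₂ (inj₁ _)) ()
parˡ-misses α V β γ W δ (inj₂ (inj₂ _)) ()

parʳ-misses : ∀ α V β γ W δ {k} l → _↪_.embed (parʳ α V β γ W δ) l ≢ inj₂ (inj₁ (inj₁ k))
parʳ-misses α V β γ W δ (inj₂ (inj₁ _)) ()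
parʳ-misses α V β γ W δ (inj₂ (inj₂ _)) ()

-- After its only write `v` keeps the value `n` through later components. A parallel union keeps it
-- as well, on the right by compatibility of the final states.
assigned-value : Run α X β → ∀ k → WrittenOnlyAt X v k → label X k ≡ inj₁ (v ← n) →
                 lookup β v ≡ just n
assigned-value (run-iso i ρ) k only eq =
  assigned-value ρ (_≅_.to i k)
    (≅-written-only i only)
    (trans (_≅_.label-≡ i k) eq)
assigned-value {v = v} (run-act {α = α} refl) (inj₂ (inj₁ _)) only refl = lookup∘update v α _
assigned-value (run-seq V μ W ρ θ) (inj₁ k) only eq =
  trans (sym (unwritten-constant θ (written-elsewhere (seqʳ V μ W) only λ _ ())))
        (assigned-value ρ (inj₁ k) (written-only (seqˡ V μ W) only) eq)
assigned-value (run-seq V μ W ρ θ) (inj₂ (inj₂ k)) only eq =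
  assigned-value θ (inj₂ k) (written-only (seqʳ V μ W) only) eq
assigned-value (run-par α V β γ W δ ρ θ _ _) (inj₂ (inj₁ (inj₁ k))) only eq =
  ⊕-left β δ (assigned-value ρ (inj₂ (inj₁ k)) (written-only (parˡ α V β γ W δ) only) eq)
assigned-value (run-par α V β γ W δ ρ θ _ c) (inj₂ (inj₁ (inj₂ k))) only eq =
  ⊕-right β δ c (assigned-value θ (inj₂ (inj₁ k)) (written-only (parʳ α V β γ W δ) only) eq)

-- With `u` never written, the value read is the initial one. Existence of the updated state also
-- makes `u` defined, which compatibility asks for in `read-before-write`.
copied-value : Run α X β → ∀ k → WrittenOnlyAt X v k → label X k ≡ inj₁ (v ←ᵛ u) →
               Unwritten X u → ∃[ n ] lookup α u ≡ just n × lookup β v ≡ just n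
copied-value (run-iso i ρ) k only eq un =
  copied-value ρ (_≅_.to i k)
    (≅-written-only i only)
    (trans (_≅_.label-≡ i k) eq)
    (unwritten (≅⇒↩ i) un)
copied-value (run-act {α = α} eq) (inj₂ (inj₁ _)) _ refl _ = copy-value α eq
copied-value (run-seq V μ W ρ θ) (inj₁ k) only eq un =
  let n , αu , βv = copied-value ρ (inj₁ k) (written-only (seqˡ V μ W) only) eq
                      (unwritten (seqˡ V μ W) un)
  in  n , αu
    , trans (sym (unwritten-constant θ (written-elsewhere (seqʳ V μ W) only λ _ ()))) βv
copied-value (run-seq V μ W ρ θ) (inj₂ (inj₂ k)) only eq un =
  let n , αu , βv = copied-value θ (inj₂ k) (written-only (seqʳ V μ W) only) eq
                      (unwritten (seqʳ V μ W) un)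
  in  n , trans (unwritten-constant ρ (unwritten (seqˡ V μ W) un)) αu , βv
copied-value (run-par α V β γ W δ ρ θ c d) (inj₂ (inj₁ (inj₁ k))) only eq un =
  let n , αu , βv = copied-value ρ (inj₂ (inj₁ k)) (written-only (parˡ α V β γ W δ) only) eq
                      (unwritten (parˡ α V β γ W δ) un)
  in  n , ⊕-left α γ αu , ⊕-left β δ βv
copied-value (run-par α V β γ W δ ρ θ c d) (inj₂ (inj₁ (inj₂ k))) only eq un =
  let n , γu , δv = copied-value θ (inj₂ (inj₁ k)) (written-only (parʳ α V β γ W δ) only) eq
                      (unwritten (parʳ α V β γ W δ) un)
  in  n , ⊕-right α γ c γu , ⊕-right β δ d δv

-- Induction down to the composition that separates the two actions. If it puts the read first, the
-- order holds; otherwise the read yields `n`, and `v` keeps it to the end.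
read-before-write :
  Run α X β → ∀ k l →
  WrittenOnlyAt X v k → label X k ≡ inj₁ (v ←ᵛ u) →
  WrittenOnlyAt X u l → label X l ≡ inj₁ (u ← n) →
  lookup β v ≢ just n → X ⊢ k ≤ l
read-before-write (run-iso i ρ) k l only-k eq-k only-l eq-l ≢n =
  Equivalence.from (_≅_.order i k l)
    (read-before-write ρ (_≅_.to i k) (_≅_.to i l)
      (≅-written-only i only-k) (trans (_≅_.label-≡ i k) eq-k)
      (≅-written-only i only-l) (trans (_≅_.label-≡ i l) eq-l) ≢n)
read-before-write (run-act _) (inj₂ (inj₁ _)) (inj₂ (inj₁ _)) _ eq-k _ eq-l _ =
  contradiction (trans (sym eq-k) eq-l) λ ()
read-before-write (run-seq V μ W ρ θ) (inj₁ k) (inj₁ l) only-k eq-k only-l eq-l ≢n =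
  _↪_.embed-≤ (seqˡ V μ W)
    (read-before-write ρ (inj₁ k) (inj₁ l)
      (written-only (seqˡ V μ W) only-k) eq-k
      (written-only (seqˡ V μ W) only-l) eq-l
      (≢n ∘ trans (sym (unwritten-constant θ (written-elsewhere (seqʳ V μ W) only-k λ _ ())))))
read-before-write (run-seq V μ W _ _) (inj₁ _) (inj₂ (inj₂ _)) _ _ _ _ _ = ₁∼₂
read-before-write (run-seq V μ W ρ θ) (inj₂ (inj₂ k)) (inj₁ l) only-k eq-k only-l eq-l ≢n =
  -- The write comes first, so the intermediate state hands `n` over to the read.
  let m , αu , βv = copied-value θ (inj₂ k) (written-only (seqʳ V μ W) only-k) eq-k
                      (written-elsewhere (seqʳ V μ W) only-l λ _ ())
      αu′ = assigned-value ρ (inj₁ l) (written-only (seqˡ V μ W) only-l) eq-l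
  in  contradiction (trans βv (trans (sym αu) αu′)) ≢n
read-before-write (run-seq V μ W ρ θ) (inj₂ (inj₂ k)) (inj₂ (inj₂ l)) only-k eq-k only-l eq-l ≢n =
  _↪_.embed-≤ (seqʳ V μ W)
    (read-before-write θ (inj₂ k) (inj₂ l)
      (written-only (seqʳ V μ W) only-k) eq-k
      (written-only (seqʳ V μ W) only-l) eq-l ≢n)
read-before-write (run-par α V β γ W δ ρ θ c d)
  (inj₂ (inj₁ (inj₁ k))) (inj₂ (inj₁ (inj₁ l))) only-k eq-k only-l eq-l ≢n =
  _↪_.embed-≤ (parˡ α V β γ W δ)
    (read-before-write ρ (inj₂ (inj₁ k)) (inj₂ (inj₁ l))
      (written-only (parˡ α V β γ W δ) only-k) eq-k
      (written-only (parˡ α V β γ W δ) only-l) eq-l (≢n ∘ ⊕-left β δ))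
read-before-write (run-par α V β γ W δ ρ θ c d)
  (inj₂ (inj₁ (inj₂ k))) (inj₂ (inj₁ (inj₂ l))) only-k eq-k only-l eq-l ≢n =
  _↪_.embed-≤ (parʳ α V β γ W δ)
    (read-before-write θ (inj₂ (inj₁ k)) (inj₂ (inj₁ l))
      (written-only (parʳ α V β γ W δ) only-k) eq-k
      (written-only (parʳ α V β γ W δ) only-l) eq-l (≢n ∘ ⊕-right β δ d))
read-before-write {u = u} (run-par α V β γ W δ ρ θ c d)
  (inj₂ (inj₁ (inj₁ k))) (inj₂ (inj₁ (inj₂ l))) only-k eq-k only-l eq-l ≢n =
  let un = written-elsewhere (parˡ α V β γ W δ) only-l (parˡ-misses α V β γ W δ)
      m , αu , βv = copied-value ρ (inj₂ (inj₁ k)) (written-only (parˡ α V β γ W δ) only-k) eq-k un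
      -- At the end, `u` has the value that was read on the reading side and `n` on the writing
      -- side; compatibility equates the two.
      βu = trans (sym (unwritten-constant ρ un)) αu
      δu = assigned-value θ (inj₂ (inj₁ l)) (written-only (parʳ α V β γ W δ) only-l) eq-l
      agree = trans (sym βu) (trans (d u (_ , βu) (_ , δu)) δu)
  in  contradiction (⊕-left β δ (trans βv agree)) ≢n
read-before-write {u = u} (run-par α V β γ W δ ρ θ c d)
  (inj₂ (inj₁ (inj₂ k))) (inj₂ (inj₁ (inj₁ l))) only-k eq-k only-l eq-l ≢n =
  let un = written-elsewhere (parʳ α V β γ W δ) only-l (parʳ-misses α V β γ W δ)
      m , γu , δv = copied-value θ (inj₂ (inj₁ k)) (written-only (parʳ α V β γ W δ) only-k) eq-k un
      δu = trans (sym (unwritten-constant θ un)) γu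
      βu = assigned-value ρ (inj₂ (inj₁ l)) (written-only (parˡ α V β γ W δ) only-l) eq-l
      agree = trans (sym δu) (trans (sym (d u (_ , βu) (_ , δu))) βu)
  in  contradiction (⊕-right β δ d (trans δv agree)) ≢n

-- No action comes after `s` or beside it, so the values fixed at `s` persist.
final-value : Run α X β → ∀ s → AboveActions X s → label X s ≡ inj₂ σ →
              lookup σ v ≡ just n → lookup β v ≡ just n
final-value (run-iso i ρ) s above eq σv =
  final-value ρ (_≅_.to i s) (≅-above-actions i above) (trans (_≅_.label-≡ i s) eq) σv
final-value (run-state _) _ _ refl σv = σv
final-value (run-act _) (inj₁ _) above _ _ = contradiction (above (inj₂ (inj₁ tt)) refl) λ ()
final-value (run-act _) (inj₂ (inj₂ _)) _ refl σv = σv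
final-value (run-seq V μ W ρ θ) (inj₁ s) above eq σv =
  trans (sym (unwritten-constant θ λ k ek _ → contradiction (above (inj₂ k) ek) λ ()))
        (final-value ρ (inj₁ s) (above-actions (seqˡ V μ W) above) eq σv)
final-value (run-seq V μ W ρ θ) (inj₂ s) above eq σv =
  final-value θ s (above-actions (seqʳ V μ W) above) eq σv
final-value ρ@(run-par α V β γ W δ _ _ _ _) (inj₁ s) above refl σv =
  -- Every action would have to lie below the first state, so there is none and the whole run leaves
  -- `v` unchanged.
  trans (sym (unwritten-constant ρ λ
    { (inj₁ _) () _ ; (inj₂ k) ek _ → contradiction (above (inj₂ k) ek) λ () })) σv
final-value (run-par α V β γ W δ ρ _ _ _) (inj₂ (inj₁ (inj₁ s))) above eq σv =
  ⊕-left β δ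
    (final-value ρ (inj₂ (inj₁ s)) (above-actions (parˡ α V β γ W δ) above) eq σv)
final-value (run-par α V β γ W δ _ θ _ d) (inj₂ (inj₁ (inj₂ s))) above eq σv =
  ⊕-right β δ d
    (final-value θ (inj₂ (inj₁ s)) (above-actions (parʳ α V β γ W δ) above) eq σv)
final-value (run-par α V β γ W δ _ _ _ _) (inj₂ (inj₂ _)) _ refl σv = σv

-- The image of the skeleton and its cycle.

⇝-written-only : (f : V ⇝ W) → ∀ {k} → WrittenOnlyAt V v k → WrittenOnlyAt W v (fun f k)
-- `cover` finds a preimage of each action of `W`, so no writer is new.
⇝-written-only f only w eq ta with cover f w eq
... | l , refl = cong (fun f) (only l (trans (sym (label-≡ f l)) eq) ta)

⇝-above-actions : (f : V ⇝ W) → ∀ {s} → AboveActions V s → AboveActions W (fun f s)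
⇝-above-actions f above w eq with cover f w eq
... | l , refl = mono f (above l (trans (sym (label-≡ f l)) eq))

-- nᵢ is the i-th action of the skeleton in reading order, nφ its final state.
pattern n₀ = inj₁ (inj₁ (inj₁ tt))
pattern n₁ = inj₁ (inj₁ (inj₂ tt))
pattern n₂ = inj₁ (inj₂ (inj₁ tt))
pattern n₃ = inj₁ (inj₂ (inj₂ tt))
pattern nφ = inj₂ tt

skeleton-written-only :
  ∀ φ → WrittenOnlyAt (skeleton φ) vx n₀ × WrittenOnlyAt (skeleton φ) r₀ n₁ ×
        WrittenOnlyAt (skeleton φ) vy n₂ × WrittenOnlyAt (skeleton φ) r₁ n₃
skeleton-written-only φ =
    (λ { n₀ _ _ → refl ; n₁ refl () ; n₂ refl () ; n₃ refl () ; nφ () _ })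
  , (λ { n₀ refl () ; n₁ _ _ → refl ; n₂ refl () ; n₃ refl () ; nφ () _ })
  , (λ { n₀ refl () ; n₁ refl () ; n₂ _ _ → refl ; n₃ refl () ; nφ () _ })
  , (λ { n₀ refl () ; n₁ refl () ; n₂ refl () ; n₃ _ _ → refl ; nφ () _ })

corollary6p6 : Empty (⦅ t ⦆↓ ∩ 𝒢)
corollary6p6 X (X∈t↓ , X∈𝒢)
  with Y , Y∈t , Y⇝X ← closure⇝ X∈t↓
  with φ , (φr₀ , φr₁) , K⇝Y ← skeleton⇝ Y∈t
  with α , β , ρ ← 𝒢⇒run X∈𝒢 =
  contradiction
    -- The images of `n₀` and `n₁` coincide, yet carry the labels `vx ← 1F` and `r₀ ←ᵛ vy`.
    (trans (sym (label-≡ f n₀)) (trans (cong (label X) n₀≡n₁) (label-≡ f n₁))) λ ()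
  where
  f = ⇝-trans K⇝Y Y⇝X
  only = skeleton-written-only φ
  only-x  = ⇝-written-only f (proj₁ only)
  only-r₀ = ⇝-written-only f (proj₁ (proj₂ only))
  only-y  = ⇝-written-only f (proj₁ (proj₂ (proj₂ only)))
  only-r₁ = ⇝-written-only f (proj₂ (proj₂ (proj₂ only)))
  -- The image of `nφ` lies above all actions, so a 0 in `φ` is final and differs from the 1 that is
  -- written.
  final : lookup φ v ≡ just 0F → lookup β v ≢ just 1F
  final φv βv = contradiction (trans (sym βv) (final-value ρ (fun f nφ)
    (⇝-above-actions f λ { (inj₁ _) _ → ₁∼₂ ; (inj₂ _) () }) (label-≡ f nφ) φv)) λ ()
  n₁≤n₂ : X ⊢ fun f n₁ ≤ fun f n₂
  n₁≤n₂ = read-before-write ρ _ _ only-r₀ (label-≡ f n₁) only-y (label-≡ f n₂) (final φr₀)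
  n₃≤n₀ : X ⊢ fun f n₃ ≤ fun f n₀
  n₃≤n₀ = read-before-write ρ _ _ only-r₁ (label-≡ f n₃) only-x (label-≡ f n₀) (final φr₁)
  n₀≡n₁ : fun f n₀ ≡ fun f n₁
  -- The skeleton orders `n₀` before `n₁` and `n₂` before `n₃`; the two reads give the other sides
  -- of the cycle.
  n₀≡n₁ = ≤-antisym X (mono f (₁∼₁ (inj₁ ₁∼₂)))
    (≤-trans X n₁≤n₂ (≤-trans X (mono f (₁∼₁ (inj₂ ₁∼₂))) n₃≤n₀))
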